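{- Let $k\ge2$. For every instance of the MHV problem with $k$ colors, the linear programming relaxation (LP-MHV) is the same as the Lovász-extension relaxation (CP-Sup-ML) of the associated Sup-ML instance with set function $g(X)=w(\iota(X))$. That is, the two programs have the same feasible assignments $(y_j^i)_{v_j\in V,\,i\in C}$, and for every such assignment, with $z_j^i,z_j$ the values determined by the constraints of (LP-MHV), $$\sum_{j=1}^n w_j z_j=\sum_{i=1}^k\hat g(\mathbf{y}_i),\qquad \mathbf{y}_i=(y_1^i,\dots,y_n^i).$$
   Context: **MHV instance.** A finite undirected graph $G=(V,E)$, $V=\{v_1,\dots,v_n\}$, non-negative vertex weights $w_j=w(v_j)$, a color set $C=\{1,\dots,k\}$, and a partial vertex coloring $c$ with colors in $C$ in which every color is used on at least one vertex. The goal in the MHV problem is to extend $c$ to all vertices maximizing the total weight of happy vertices (vertices having the same color as all their neighbors). **(LP-MHV).** Maximize $\sum_{j=1}^n w_jz_j$ subject to: $\sum_{i=1}^k y_j^i=1$ for all $v_j\in V$; $y_j^i=1$ whenever $c(v_j)=i$; $z_j^i=\min_{v_h\in N[v_j]}y_h^i$ for all $v_j\in V$, $i\in C$; $z_j=\sum_{i=1}^k z_j^i$ for all $v_j\in V$; and $z_j,z_j^i,y_j^i\ge0$. Here $N[v_j]$ is the closed neighborhood of $v_j$. **Set function.** For $X\subseteq V$, $\partial(X)$ is the set of vertices of $X$ with at least one neighbor outside $X$, $\iota(X)=X\setminus\partial(X)$, $w(X)=\sum_{v\in X}w(v)$, $g(X)=w(\iota(X))$. **Lovász extension.** For $\mathbf{y}\in[0,1]^V$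 with maximum coordinate $1$ and minimum coordinate $0$, let $\pi$ be a permutation with $1=y_{\pi_1}\ge\dots\ge y_{\pi_n}=0$ and set $\hat g(\mathbf{y})=\sum_{j=1}^{n-1}(y_{\pi_j}-y_{\pi_{j+1}})\,g(\{v_{\pi_1},\dots,v_{\pi_j}\})$. **(CP-Sup-ML)** for this instance. Maximize $\sum_{i=1}^k\hat g(\mathbf{y}_i)$ subject to $\sum_{i=1}^k y_j^i=1$ for all $v_j\in V$; $y_j^i=1$ whenever $c(v_j)=i$; $y_j^i\ge0$ for all $v_j\in V$, $i\in C$. -}

module Defs where

open import Algebra.Bundles using (CommutativeRing)
open import Data.Bool.Base using (if_then_else_)
open import Data.Empty using (⊥)
open import Data.Fin.Base using (Fin; zero; suc; inject₁; fromℕ)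
open import Data.Fin.Permutation using (Permutation′; _⟨$⟩ʳ_; _⟨$⟩ˡ_)
open import Data.Fin.Properties using (any?; _≤?_)
open import Data.Fin.Subset using (Subset; _∈_; _∉_; _─_)
open import Data.Fin.Subset.Properties using (_∈?_)
open import Data.List.Base using (List; map; filter; allFin)
import Data.List.Extrema as Extrema
open import Data.Maybe.Base using (Maybe; just)
open import Data.Nat.Base using (ℕ; zero; suc)
open import Data.Product.Base using (∃-syntax; _×_)
open import Data.Vec.Base using (lookup; tabulate)
open import Level using (Level; 0ℓ; _⊔_; Lift) renaming (suc to lsuc)
open import Relation.Binary.Bundles using (TotalOrder)
open import Relation.Binary.Core using (Rel)
open import Relation.Binary.Definitions using (Symmetric; Decidable)
open import Relation.Binary.PropositionalEquality.Core using (_≡_)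
open import Relation.Binary.Structures using (IsTotalOrder)
open import Relation.Nullary.Decidable using (does; _×-dec_; ¬?)
open import Relation.Nullary.Negation using (¬_)
import Algebra.Properties.Semiring.Sum as Sum

-- The scalars stand in for ℝ, which satisfies these axioms classically (as
-- does ℚ, constructively).
record OrderedField (c ℓ₁ ℓ₂ : Level) : Set (lsuc (c ⊔ ℓ₁ ⊔ ℓ₂)) where
  infix 4 _≤_
  field
    commutativeRing : CommutativeRing c ℓ₁

  open CommutativeRing commutativeRing public

  field
    _≤_          : Rel Carrier ℓ₂
    isTotalOrder : IsTotalOrder _≈_ _≤_
    +-monoˡ-≤    : ∀ z {x y} → x ≤ y → x + z ≤ y + z
    *-nonNeg     : ∀ {x y} → 0# ≤ x → 0# ≤ y → 0# ≤ x * y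
    0≉1          : ¬ 0# ≈ 1#
    inverse      : ∀ x → ¬ x ≈ 0# → ∃[ y ] x * y ≈ 1#

  totalOrder : TotalOrder c ℓ₁ ℓ₂
  totalOrder = record { isTotalOrder = isTotalOrder }

-- Loops are not excluded: they affect neither closed neighbourhoods nor
-- boundaries.
record Graph (n : ℕ) : Set₁ where
  field
    Adj       : Rel (Fin n) 0ℓ
    Adj-sym   : Symmetric Adj
    adjacent? : Decidable Adj

  neighbours : Fin n → List (Fin n)
  neighbours v = filter (adjacent? v) (allFin n)

  ∂ : Subset n → Subset n
  ∂ X = tabulate λ v →
    does (v ∈? X ×-dec any? λ u → adjacent? v u ×-dec ¬? (u ∈? X))

  ι : Subset n → Subset n
  ι X = X ─ ∂ X

-- The set { π₀ , … , πⱼ }, as the elements whose position is at most j.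
prefix : ∀ {n} → Permutation′ n → Fin n → Subset n
prefix π j = tabulate λ v → does (π ⟨$⟩ˡ v ≤? j)

module MHV {c ℓ₁ ℓ₂} (F : OrderedField c ℓ₁ ℓ₂) where
  open OrderedField F hiding (zero)
  open Sum semiring using (sum-syntax)
  open Extrema totalOrder using (min)

  record Instance (n k : ℕ) : Set (lsuc 0ℓ ⊔ c ⊔ ℓ₂) where
    field
      graph       : Graph n
      w           : Fin n → Carrier
      w-nonNeg    : ∀ v → 0# ≤ w v
      colour      : Fin n → Maybe (Fin k)
      colour-used : ∀ i → ∃[ v ] colour v ≡ just i

    open Graph graph public

    weight : Subset n → Carrier
    weight X = ∑[ v < n ] (if lookup X v then w v else 0#)

    g : Subset n → Carrier
    g X = weight (ι X)

    -- The minimum of f over the closed neighbourhood of v; f v is the first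
    -- argument of min, so that no value other than those of f enters.
    minN[_] : Fin n → (Fin n → Carrier) → Carrier
    minN[ v ] f = min (f v) (map f (neighbours v))

  record SortsNonempty {m} (π : Permutation′ (suc m))
                       (y : Fin (suc m) → Carrier) : Set (ℓ₁ ⊔ ℓ₂) where
    field
      first      : y (π ⟨$⟩ʳ zero) ≈ 1#
      decreasing : ∀ (j : Fin m) → y (π ⟨$⟩ʳ suc j) ≤ y (π ⟨$⟩ʳ inject₁ j)
      last       : y (π ⟨$⟩ʳ fromℕ m) ≈ 0#

  -- 1 = y_{π₁} ≥ … ≥ y_{πₙ} = 0.  A y admitting such a π is exactly a point of
  -- [0,1]ⁿ with maximum coordinate 1 and minimum coordinate 0, i.e. a point
  -- at which the Lovász extension is defined.
  Sorts : ∀ {n} → Permutation′ n → (Fin n → Carrier) → Set (ℓ₁ ⊔ ℓ₂)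
  Sorts {zero}  π y = Lift _ ⊥
  Sorts {suc m} π y = SortsNonempty π y

  -- The Lovász extension of f at y, computed along π; meaningful when
  -- Sorts π y.  In the sum, inject₁ j and suc j are consecutive positions.
  lovász : ∀ {n} → (Subset n → Carrier) →
           Permutation′ n → (Fin n → Carrier) → Carrier
  lovász {zero}  f π y = 0#
  lovász {suc m} f π y =
    ∑[ j < m ] ((y (π ⟨$⟩ʳ inject₁ j) - y (π ⟨$⟩ʳ suc j))
                * f (prefix π (inject₁ j)))

  module _ {n k : ℕ} (I : Instance n k) where
    open Instance I

    -- y v i is the variable y_v^i, and zᶜ v i is z_v^i.

    record LP-Constraints (y zᶜ : Fin n → Fin k → Carrier)
                          (z : Fin n → Carrier) : Set (ℓ₁ ⊔ ℓ₂) where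
      field
        y-sum     : ∀ v → ∑[ i < k ] y v i ≈ 1#
        y-colour  : ∀ v i → colour v ≡ just i → y v i ≈ 1#
        zᶜ-min    : ∀ v i → zᶜ v i ≈ minN[ v ] (λ u → y u i)
        z-sum     : ∀ v → z v ≈ ∑[ i < k ] zᶜ v i
        z-nonNeg  : ∀ v → 0# ≤ z v
        zᶜ-nonNeg : ∀ v i → 0# ≤ zᶜ v i
        y-nonNeg  : ∀ v i → 0# ≤ y v i

    LP-Feasible : (Fin n → Fin k → Carrier) → Set (c ⊔ ℓ₁ ⊔ ℓ₂)
    LP-Feasible y = ∃[ zᶜ ] ∃[ z ] LP-Constraints y zᶜ z

    LP-objective : (Fin n → Carrier) → Carrier
    LP-objective z = ∑[ v < n ] (w v * z v)

    record CP-Feasible (y : Fin n → Fin k → Carrier) : Set (ℓ₁ ⊔ ℓ₂) where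
      field
        y-sum    : ∀ v → ∑[ i < k ] y v i ≈ 1#
        y-colour : ∀ v i → colour v ≡ just i → y v i ≈ 1#
        y-nonNeg : ∀ v i → 0# ≤ y v i

    CP-objective : (Fin k → Permutation′ n) → (Fin n → Fin k → Carrier) → Carrier
    CP-objective π y = ∑[ i < k ] lovász g (π i) (λ v → y v i)

{-# OPTIONS --safe #-}

-- Fix a colour i, sort the vertices by decreasing y^i, and let p be the last
-- position at which a vertex of N[v] occurs.  Then N[v] is contained in the
-- prefix { π₁ , … , πⱼ } exactly when p ≤ j, so v contributes w(v) to
-- g({ π₁ , … , πⱼ }) for precisely those j, and its total contribution to
-- ĝ(yᵢ) telescopes to w(v) (y_{π_p} − y_{πₙ}) = w(v) y_{π_p}, which is
-- w(v) times the minimum of y^i over N[v].  The coordinate values 1 and 0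
-- are attained by vertices precoloured i and precoloured otherwise (k ≥ 2).
module Submission where

open import Defs
open import Data.Bool.Base using (Bool; true; false; if_then_else_)
open import Data.Bool.Properties using (¬-not)
open import Data.Fin.Base as Fin using (Fin; zero; suc; inject₁; fromℕ; punchIn; punchOut)
open import Data.Fin.Permutation as Perm
  using (Permutation′; _⟨$⟩ʳ_; _⟨$⟩ˡ_; inverseʳ; insert; insert-punchIn)
open import Data.Fin.Properties as Fin using (_≤?_; ≤fromℕ; punchIn-punchOut)
open import Data.Fin.Subset using (Subset; _∈_; _∉_; _─_)
open import Data.Fin.Subset.Properties using (_∈?_; p─q⊆p; x∈p∧x∉q⇒x∈p─q)
open import Data.List.Base using (allFin; map)
import Data.List.Extrema as Extrema
open import Data.List.Membership.Propositional.Properties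
  using (∈-allFin; ∈-filter⁺; ∈-filter⁻)
open import Data.List.Relation.Unary.All as All using (All)
import Data.List.Relation.Unary.All.Properties as All
open import Data.Nat.Base using (ℕ; zero; suc; z≤n; s≤s; s≤s⁻¹)
  renaming (_≤_ to _≤ℕ_)
open import Data.Nat.Properties using (n≤1+n)
open import Data.Product.Base using (_×_; _,_; proj₁; proj₂; ∃-syntax)
open import Data.Vec.Base as Vec using (_∷_; lookup; tabulate)
open import Data.Vec.Functional using (removeAt)
open import Data.Vec.Properties using ([]=⇒lookup; lookup⇒[]=; lookup∘tabulate)
open import Function.Base using (_∘_)
open import Function.Bundles using (_⇔_; mk⇔; Equivalence)
open import Level using (Level)
open import Relation.Binary.Bundles using (TotalOrder)
import Relation.Binary.PropositionalEquality as ≡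
open ≡ using (_≡_; _≢_)
open import Relation.Nullary.Decidable
  using (Dec; yes; no; does; dec-true; does-⇔; decidable-stable; ¬?; _×-dec_)
import Relation.Binary.Reasoning.PartialOrder
import Relation.Binary.Reasoning.Setoid
import Algebra.Properties.Semiring.Sum
import Algebra.Properties.Ring

open Equivalence using (to; from)

private variable
  a : Level
  A : Set a
  n : ℕ

-- Preliminaries on finite sets and subsets.

∃-other : 2 ≤ℕ n → (i : Fin n) → ∃[ j ] j ≢ i
∃-other (s≤s (s≤s _)) zero    = suc zero , λ ()
∃-other (s≤s (s≤s _)) (suc i) = zero , λ ()

x∈p─q⇒x∉q : ∀ {x : Fin n} (p q : Subset n) → x ∈ p ─ q → x ∉ q
x∈p─q⇒x∉q (true ∷ p)  (true ∷ q) () Vec.here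
x∈p─q⇒x∉q (false ∷ p) (true ∷ q) () Vec.here
x∈p─q⇒x∉q (_ ∷ p) (_ ∷ q) (Vec.there x∈p─q) (Vec.there x∈q) = x∈p─q⇒x∉q p q x∈p─q x∈q

does≡true⇒ : (A? : Dec A) → does A? ≡ true → A
does≡true⇒ (yes x) _ = x

-- Both `∂` and `prefix` are tabulated from a decision procedure; this turns membership in either
-- into the property decided.
∈-tabulate-does : ∀ {P : Fin n → Set a} (P? : ∀ v → Dec (P v)) {v} →
                  v ∈ tabulate (λ u → does (P? u)) ⇔ P v
∈-tabulate-does P? {v} = mk⇔
  (λ v∈ → does≡true⇒ (P? v) (≡.trans (≡.sym (lookup∘tabulate _ v)) ([]=⇒lookup v∈)))
  (λ Pv → lookup⇒[]= v _ (≡.trans (lookup∘tabulate _ v) (dec-true (P? v) Pv)))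

-- Bridges two forms of the same indicator: `weight` tests membership by `lookup`, while the
-- telescoping sum tests a comparison of positions by `does`.
lookup≡does : ∀ {X : Subset n} {v} → v ∈ X ⇔ A → (A? : Dec A) → lookup X v ≡ does A?
lookup≡does {X = X} {v} v∈X⇔A (yes x) = []=⇒lookup (from v∈X⇔A x)
lookup≡does {X = X} {v} v∈X⇔A (no ¬x) = ¬-not (¬x ∘ to v∈X⇔A ∘ lookup⇒[]= v X)

-- Interiors of prefixes of a permutation.

module _ (G : Graph n) where
  open Graph G

  ∈∂⇔ : ∀ {X v} → v ∈ ∂ X ⇔ (v ∈ X × ∃[ u ] Adj v u × u ∉ X)
  ∈∂⇔ {X} = ∈-tabulate-does λ v →
    v ∈? X ×-dec Fin.any? λ u → adjacent? v u ×-dec ¬? (u ∈? X)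

  ∈ι⇔N[v]⊆ : ∀ {X v} → v ∈ ι X ⇔ (v ∈ X × All (_∈ X) (neighbours v))
  ∈ι⇔N[v]⊆ {X} {v} = mk⇔
    (λ v∈ι → let v∈X = p─q⊆p X (∂ X) v∈ι in
      -- A neighbour outside `X` would put `v` in `∂ X`; decidability of membership removes the
      -- double negation.
      v∈X , All.tabulate λ {u} u∈nbr → decidable-stable (u ∈? X) λ u∉X →
        x∈p─q⇒x∉q X (∂ X) v∈ι
          (from ∈∂⇔
            (v∈X , u , proj₂ (∈-filter⁻ (adjacent? v) {xs = allFin n} u∈nbr) , u∉X)))
    (λ (v∈X , nbrs⊆X) → x∈p∧x∉q⇒x∈p─q v∈X λ v∈∂ →
      let _ , u , v~u , u∉X = to ∈∂⇔ v∈∂ in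
      u∉X (All.lookup nbrs⊆X (∈-filter⁺ (adjacent? v) (∈-allFin u) v~u)))

  module _ (π : Permutation′ n) where
    open Extrema (Fin.≤-totalOrder n)

    position : Fin n → Fin n
    position = π ⟨$⟩ˡ_

    -- The default of `argmax` is `v` itself, so the maximum ranges over the closed neighbourhood,
    -- as in `minN`.
    lastN[_] : Fin n → Fin n
    lastN[ v ] = argmax position v (neighbours v)

    position≤lastN : ∀ v → position v Fin.≤ position lastN[ v ]
    position≤lastN v = f[⊥]≤f[argmax] {f = position} v (neighbours v)

    position-nbrs≤lastN : ∀ v → All (λ u → position u Fin.≤ position lastN[ v ]) (neighbours v)
    position-nbrs≤lastN v = f[xs]≤f[argmax] {f = position} v (neighbours v)

    -- `argmax` returns either its default or an entry of the list, hence a member of N[v].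
    lastN-all : ∀ {p} {P : Fin n → Set p} {v} → P v → All P (neighbours v) → P lastN[ v ]
    lastN-all {P = P} = argmax-all position {P = P}

    -- A prefix is closed under passing to earlier positions, so it contains N[v] as soon as it
    -- contains the member of N[v] that comes last.
    ∈ι-prefix⇔ : ∀ {v j} → v ∈ ι (prefix π j) ⇔ position lastN[ v ] Fin.≤ j
    ∈ι-prefix⇔ {v} {j} = mk⇔
      (λ v∈ι → let v∈X , nbrs⊆X = to ∈ι⇔N[v]⊆ v∈ι in
        lastN-all {P = λ u → position u Fin.≤ j} (to ∈prefix v∈X) (All.map (to ∈prefix) nbrs⊆X))
      (λ last≤j → from ∈ι⇔N[v]⊆
        ( from ∈prefix (Fin.≤-trans (position≤lastN v) last≤j)
        , All.map (λ u≤last → from ∈prefix (Fin.≤-trans u≤last last≤j)) (position-nbrs≤lastN v)))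
      where
      ∈prefix : ∀ {u} → u ∈ prefix π j ⇔ position u Fin.≤ j
      ∈prefix = ∈-tabulate-does (λ u → position u ≤? j)

module _ {c ℓ₁ ℓ₂} (F : OrderedField c ℓ₁ ℓ₂) where
  open OrderedField F hiding (zero)
  open MHV F
  open Algebra.Properties.Semiring.Sum semiring
  open Algebra.Properties.Ring ring using (-0#≈0#; +-cancelˡ)
  open TotalOrder totalOrder using (poset; antisym)
    renaming (refl to ≤-refl; reflexive to ≤-reflexive; trans to ≤-trans)
  private
    module ≤-Reasoning = Relation.Binary.Reasoning.PartialOrder poset
    module ≈-Reasoning = Relation.Binary.Reasoning.Setoid setoid
    module Ext = Extrema totalOrder

  -- Sums of non-negative terms.

  +-monoʳ-≤ : ∀ z {x y} → x ≤ y → z + x ≤ z + y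
  +-monoʳ-≤ z {x} {y} x≤y = begin
    z + x ≈⟨ +-comm z x ⟩
    x + z ≤⟨ +-monoˡ-≤ z x≤y ⟩
    y + z ≈⟨ +-comm y z ⟩
    z + y ∎
    where open ≤-Reasoning

  sum-nonNeg : (f : Fin n → Carrier) → (∀ i → 0# ≤ f i) → 0# ≤ sum f
  sum-nonNeg {zero}  f f≥0 = ≤-refl
  sum-nonNeg {suc n} f f≥0 = begin
    0#                         ≤⟨ f≥0 zero ⟩
    f zero                     ≈⟨ +-identityʳ (f zero) ⟨
    f zero + 0#                ≤⟨ +-monoʳ-≤ (f zero) (sum-nonNeg (f ∘ suc) (f≥0 ∘ suc)) ⟩
    f zero + sum (f ∘ suc)     ∎
    where open ≤-Reasoning

  summand≤sum : (f : Fin n → Carrier) → (∀ i → 0# ≤ f i) → ∀ i → f i ≤ sum f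
  summand≤sum {suc n} f f≥0 i = begin
    f i                        ≈⟨ +-identityʳ (f i) ⟨
    f i + 0#                   ≤⟨ +-monoʳ-≤ (f i) (sum-nonNeg (removeAt f i) (f≥0 ∘ punchIn i)) ⟩
    f i + sum (removeAt f i)   ≈⟨ sum-remove f ⟨
    sum f                      ∎
    where open ≤-Reasoning

  -- If `f i` exhausts the sum, the other terms add up to 0, and each of them lies between 0 and
  -- that remainder.
  other-summand≈0 : (f : Fin n → Carrier) → (∀ i → 0# ≤ f i) →
                    ∀ {i j} → i ≢ j → f i ≈ sum f → f j ≈ 0#
  other-summand≈0 {suc n} f f≥0 {i} {j} i≢j fi≈sum = antisym fj≤0 (f≥0 j)
    where
    rest≈0 : sum (removeAt f i) ≈ 0#
    rest≈0 = +-cancelˡ (f i) _ _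
      (trans (sym (sum-remove f)) (trans (sym fi≈sum) (sym (+-identityʳ (f i)))))

    open ≤-Reasoning
    fj≤0 : f j ≤ 0#
    fj≤0 = begin
      f j                            ≡⟨ ≡.cong f (punchIn-punchOut i≢j) ⟨
      removeAt f i (punchOut i≢j)    ≤⟨ summand≤sum (removeAt f i) (f≥0 ∘ punchIn i) (punchOut i≢j) ⟩
      sum (removeAt f i)             ≈⟨ rest≈0 ⟩
      0#                             ∎

  -- Sorting a vector of scalars.

  decreasing⇒antitone : (h : Fin (suc n) → Carrier) → (∀ j → h (suc j) ≤ h (inject₁ j)) →
                        ∀ i j → i Fin.≤ j → h j ≤ h i
  decreasing⇒antitone h dec zero zero _ = ≤-refl
  decreasing⇒antitone {suc n} h dec zero (suc j) _ =
    ≤-trans (decreasing⇒antitone (h ∘ suc) (dec ∘ suc) zero j z≤n) (dec zero)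
  decreasing⇒antitone {suc n} h dec (suc i) (suc j) (s≤s i≤j) =
    decreasing⇒antitone (h ∘ suc) (dec ∘ suc) i j i≤j

  -- Selection sort: an index of greatest value goes to position 0, and the remaining indices,
  -- reached through `punchIn top`, are sorted recursively.
  sort : (y : Fin n → Carrier) →
         ∃[ π ] ∀ (i j : Fin n) → i Fin.≤ j → y (π ⟨$⟩ʳ j) ≤ y (π ⟨$⟩ʳ i)
  sort {zero}  y = Perm.id , λ ()
  sort {suc n} y = insert zero top π , antitone
    where
    top : Fin (suc n)
    top = Ext.argmax y zero (allFin (suc n))

    π : Permutation′ n
    π = proj₁ (sort (y ∘ punchIn top))

    antitone : ∀ i j → i Fin.≤ j →
               y (insert zero top π ⟨$⟩ʳ j) ≤ y (insert zero top π ⟨$⟩ʳ i)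
    antitone zero j _ =
      All.lookup (Ext.f[xs]≤f[argmax] {f = y} zero (allFin (suc n)))
                 (∈-allFin (insert zero top π ⟨$⟩ʳ j))
    antitone (suc i) (suc j) (s≤s i≤j) = begin
      y (insert zero top π ⟨$⟩ʳ suc j) ≡⟨ ≡.cong y (insert-punchIn zero top π j) ⟩
      y (punchIn top (π ⟨$⟩ʳ j))       ≤⟨ proj₂ (sort (y ∘ punchIn top)) i j i≤j ⟩
      y (punchIn top (π ⟨$⟩ʳ i))       ≡⟨ ≡.cong y (insert-punchIn zero top π i) ⟨
      y (insert zero top π ⟨$⟩ʳ suc i) ∎
      where open ≤-Reasoning

  -- Sorted values start no lower than `y u`, which is 1, and end no higher than `y v`, which is 0;
  -- the bounds on `y` turn both inequalities into equalities.
  sorting-exists : (y : Fin n → Carrier) → (∀ v → 0# ≤ y v) → (∀ v → y v ≤ 1#) →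
                   ∀ {u v} → y u ≈ 1# → y v ≈ 0# → ∃[ π ] Sorts π y
  sorting-exists {suc n} y y≥0 y≤1 {u} {v} yu≈1 yv≈0 = π , record
    { first      = antisym (y≤1 _) (begin
        1#                          ≈⟨ yu≈1 ⟨
        y u                         ≡⟨ ≡.cong y (inverseʳ π) ⟨
        y (π ⟨$⟩ʳ (π ⟨$⟩ˡ u))       ≤⟨ antitone zero (π ⟨$⟩ˡ u) z≤n ⟩
        y (π ⟨$⟩ʳ zero)             ∎)
    ; decreasing = λ j → antitone (inject₁ j) (suc j)
        (≡.subst (_≤ℕ suc (Fin.toℕ j)) (≡.sym (Fin.toℕ-inject₁ j)) (n≤1+n _))
    ; last       = antisym (begin
        y (π ⟨$⟩ʳ fromℕ n)          ≤⟨ antitone (π ⟨$⟩ˡ v) (fromℕ n) (≤fromℕ _) ⟩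
        y (π ⟨$⟩ʳ (π ⟨$⟩ˡ v))       ≡⟨ ≡.cong y (inverseʳ π) ⟩
        y v                         ≈⟨ yv≈0 ⟩
        0#                          ∎) (y≥0 _)
    }
    where
    open ≤-Reasoning
    π = proj₁ (sort y)
    antitone = proj₂ (sort y)

  -- Telescoping, and minima over closed neighbourhoods.

  [x-y]+[y-z]≈x-z : ∀ x y z → (x - y) + (y - z) ≈ x - z
  [x-y]+[y-z]≈x-z x y z = begin
    (x - y) + (y - z)       ≈⟨ +-assoc x (- y) (y - z) ⟩
    x + (- y + (y - z))     ≈⟨ +-congˡ (+-assoc (- y) y (- z)) ⟨
    x + ((- y + y) - z)     ≈⟨ +-congˡ (+-congʳ (-‿inverseˡ y)) ⟩
    x + (0# - z)            ≈⟨ +-congˡ (+-identityˡ (- z)) ⟩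
    x - z                   ∎
    where open ≈-Reasoning

  telescope-from : ∀ {m} (h : Fin (suc m) → Carrier) (p : Fin (suc m)) →
    ∑[ j < m ] (if does (p ≤? inject₁ j) then h (inject₁ j) - h (suc j) else 0#)
    ≈ h p - h (fromℕ m)
  telescope-from {zero}  h zero = sym (-‿inverseʳ (h zero))
  telescope-from {suc m} h zero =
    trans (+-congˡ (telescope-from (h ∘ suc) zero))
          ([x-y]+[y-z]≈x-z (h zero) (h (suc zero)) (h (fromℕ (suc m))))
  -- The term at position 0 computes to `0#`; the later tests are those for `p` with both sides
  -- shifted by one.
  telescope-from {suc m} h (suc p) = trans (+-identityˡ _) (trans
    (sum-cong-≋ λ j → reflexive (≡.cong
      (λ b → if b then h (suc (inject₁ j)) - h (suc (suc j)) else 0#)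
      (does-⇔ (mk⇔ s≤s⁻¹ s≤s) (suc p ≤? suc (inject₁ j)) (p ≤? inject₁ j))))
    (telescope-from (h ∘ suc) p))

  -- Moves the indicator from the drop in `y` to the vertex weight, where `weight` has it.
  *-if-comm : ∀ b x y → x * (if b then y else 0#) ≈ y * (if b then x else 0#)
  *-if-comm true  x y = *-comm x y
  *-if-comm false x y = trans (zeroʳ x) (sym (zeroʳ y))

  -- The last member of N[v] is among the vertices compared, so its value bounds the minimum from
  -- above. Values only fall along `π`, so it is also a lower bound for all of them.
  minN≈last : ∀ {m k} (I : Instance (suc m) k)
    (π : Permutation′ (suc m)) (y : Fin (suc m) → Carrier) →
    Sorts π y → let open Instance I in
    ∀ v → minN[ v ] y ≈ y (lastN[_] graph π v)
  minN≈last I π y sorts v = antisym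
    (lastN-all graph π (Ext.min≤⊤ (y v) (map y (neighbours v)))
      (All.map⁻ (Ext.min≤xs (y v) (map y (neighbours v)))))
    (Ext.v≤min⁺ (later⇒smaller v (lastN[_] graph π v) (position≤lastN graph π v))
      (All.map⁺ (All.map (later⇒smaller _ (lastN[_] graph π v)) (position-nbrs≤lastN graph π v))))
    where
    open Instance I
    open SortsNonempty sorts
    open ≤-Reasoning
    later⇒smaller : ∀ u u′ → π ⟨$⟩ˡ u Fin.≤ π ⟨$⟩ˡ u′ → y u′ ≤ y u
    later⇒smaller u u′ u≤u′ = begin
      y u′                       ≡⟨ ≡.cong y (inverseʳ π) ⟨
      y (π ⟨$⟩ʳ (π ⟨$⟩ˡ u′))     ≤⟨ decreasing⇒antitone (y ∘ (π ⟨$⟩ʳ_)) decreasing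
                                    (π ⟨$⟩ˡ u) (π ⟨$⟩ˡ u′) u≤u′ ⟩
      y (π ⟨$⟩ʳ (π ⟨$⟩ˡ u))      ≡⟨ ≡.cong y (inverseʳ π) ⟩
      y u                        ∎

  minN≈∑ : ∀ {m k} (I : Instance (suc m) k)
    (π : Permutation′ (suc m)) (y : Fin (suc m) → Carrier) →
    Sorts π y → let open Instance I in
    ∀ v → minN[ v ] y ≈
      ∑[ j < m ] (if lookup (ι (prefix π (inject₁ j))) v
                  then y (π ⟨$⟩ʳ inject₁ j) - y (π ⟨$⟩ʳ suc j) else 0#)
  minN≈∑ {m} I π y sorts v = begin
    minN[ v ] y                                   ≈⟨ minN≈last I π y sorts v ⟩
    y u                                           ≡⟨ ≡.cong y (inverseʳ π) ⟨
    h p                                           ≈⟨ +-identityʳ (h p) ⟨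
    -- The coordinate in the last position is 0; it is inserted as the far end of the telescoping
    -- sum.
    h p + 0#                                      ≈⟨ +-congˡ -0#≈0# ⟨
    h p - 0#                                      ≈⟨ +-congˡ (-‿cong last) ⟨
    h p - h (fromℕ m)                             ≈⟨ telescope-from h p ⟨
    ∑[ j < m ] (if does (p ≤? inject₁ j) then h (inject₁ j) - h (suc j) else 0#)
      ≡⟨ sum-cong-≗ (λ j → ≡.cong (λ b → if b then h (inject₁ j) - h (suc j) else 0#)
           (lookup≡does (∈ι-prefix⇔ graph π) (p ≤? inject₁ j))) ⟨
    ∑[ j < m ] (if lookup (ι (prefix π (inject₁ j))) v
                then h (inject₁ j) - h (suc j) else 0#) ∎
    where
    open Instance I
    open SortsNonempty sorts
    open ≈-Reasoning
    u = lastN[_] graph π v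
    p = π ⟨$⟩ˡ u
    h = y ∘ (π ⟨$⟩ʳ_)

  -- Exchanging the sums over vertices and positions groups the terms by prefix: for fixed `j`, the
  -- weights of the vertices interior to the prefix add up to its value under `g`.
  ∑w*minN≈lovász : ∀ {n k} (I : Instance n k) (π : Permutation′ n) (y : Fin n → Carrier) →
    Sorts π y → let open Instance I in
    ∑[ v < n ] (w v * minN[ v ] y) ≈ lovász g π y
  ∑w*minN≈lovász {suc m} I π y sorts = begin
    ∑[ v < suc m ] (w v * minN[ v ] y)
      ≈⟨ sum-cong-≋ (λ v → *-congˡ {w v} (minN≈∑ I π y sorts v)) ⟩
    ∑[ v < suc m ] (w v * ∑[ j < m ] (if inside v j then Δ j else 0#))
      ≈⟨ sum-cong-≋ (λ v → *-distribˡ-sum (w v) (λ j → if inside v j then Δ j else 0#)) ⟩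
    ∑[ v < suc m ] ∑[ j < m ] (w v * (if inside v j then Δ j else 0#))
      ≈⟨ ∑-comm (λ v j → w v * (if inside v j then Δ j else 0#)) ⟩
    ∑[ j < m ] ∑[ v < suc m ] (w v * (if inside v j then Δ j else 0#))
      ≈⟨ sum-cong-≋ (λ j → sum-cong-≋ λ v → *-if-comm (inside v j) (w v) (Δ j)) ⟩
    ∑[ j < m ] ∑[ v < suc m ] (Δ j * (if inside v j then w v else 0#))
      ≈⟨ sum-cong-≋ (λ j → *-distribˡ-sum (Δ j) (λ v → if inside v j then w v else 0#)) ⟨
    ∑[ j < m ] (Δ j * g (prefix π (inject₁ j)))
      ∎
    where
    open Instance I
    open ≈-Reasoning
    inside : Fin (suc m) → Fin m → Bool
    inside v j = lookup (ι (prefix π (inject₁ j))) v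
    Δ : Fin m → Carrier
    Δ j = y (π ⟨$⟩ʳ inject₁ j) - y (π ⟨$⟩ʳ suc j)

  -- Comparison of the two programs.

  module _ {n k : ℕ} (I : Instance n k) where
    open Instance I

    minN-nonNeg : ∀ v (f : Fin n → Carrier) → (∀ u → 0# ≤ f u) → 0# ≤ minN[ v ] f
    minN-nonNeg v f f≥0 =
      Ext.v≤min⁺ (f≥0 v) (All.map⁺ (All.universal f≥0 (neighbours v)))

    -- The constraints determine `zᶜ` and `z` from `y`, and these are non-negative as minima and
    -- sums of non-negative values.
    LP⇔CP : ∀ y → LP-Feasible I y ⇔ CP-Feasible I y
    LP⇔CP y = mk⇔
      (λ (_ , _ , lp) → let open LP-Constraints lp in record
        { y-sum = y-sum ; y-colour = y-colour ; y-nonNeg = y-nonNeg })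
      (λ cp → let open CP-Feasible cp
                  zᶜ≥0 = λ v i → minN-nonNeg v (λ u → y u i) (λ u → y-nonNeg u i)
              in
        (λ v i → minN[ v ] (λ u → y u i)) , (λ v → ∑[ i < k ] minN[ v ] (λ u → y u i)) , record
        { y-sum     = y-sum
        ; y-colour  = y-colour
        ; zᶜ-min    = λ _ _ → refl
        ; z-sum     = λ _ → refl
        ; z-nonNeg  = λ v → sum-nonNeg _ (zᶜ≥0 v)
        ; zᶜ-nonNeg = zᶜ≥0
        ; y-nonNeg  = y-nonNeg
        })

    feasible-sortable : 2 ≤ℕ k → ∀ {y} → CP-Feasible I y → ∀ i → ∃[ π ] Sorts π (λ v → y v i)
    feasible-sortable 2≤k {y} cp i =
      let j , j≢i = ∃-other 2≤k i
          u , cu≡i = colour-used i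
          v , cv≡j = colour-used j
      in sorting-exists (λ v → y v i) (λ v → y-nonNeg v i)
           -- One colour's share at a vertex is at most the total, which is 1.
           (λ v → ≤-trans (summand≤sum (y v) (y-nonNeg v) i) (≤-reflexive (y-sum v)))
           (y-colour u i cu≡i)
           -- At `v`, precoloured `j`, colour `j` takes the whole total 1 and leaves 0 for `i`.
           (other-summand≈0 (y v) (y-nonNeg v) j≢i (trans (y-colour v j cv≡j) (sym (y-sum v))))
      where open CP-Feasible cp

    -- Summing the identity for a single colour over all colours. The left side does not mention
    -- `π`, so ties may be broken arbitrarily.
    objectives-agree : ∀ {y zᶜ z} → LP-Constraints I y zᶜ z →
      (π : Fin k → Permutation′ n) → (∀ i → Sorts (π i) (λ v → y v i)) →
      LP-objective I z ≈ CP-objective I π y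
    objectives-agree {y} {zᶜ} {z} lp π sorts = begin
      ∑[ v < n ] (w v * z v)
        ≈⟨ sum-cong-≋ (λ v → *-congˡ (trans (z-sum v) (sum-cong-≋ (zᶜ-min v)))) ⟩
      ∑[ v < n ] (w v * ∑[ i < k ] minN[ v ] (λ u → y u i))
        ≈⟨ sum-cong-≋ (λ v → *-distribˡ-sum (w v) (λ i → minN[ v ] (λ u → y u i))) ⟩
      ∑[ v < n ] ∑[ i < k ] (w v * minN[ v ] (λ u → y u i))
        ≈⟨ ∑-comm (λ v i → w v * minN[ v ] (λ u → y u i)) ⟩
      ∑[ i < k ] ∑[ v < n ] (w v * minN[ v ] (λ u → y u i))
        ≈⟨ sum-cong-≋ (λ i → ∑w*minN≈lovász I (π i) (λ u → y u i) (sorts i)) ⟩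
      ∑[ i < k ] lovász g (π i) (λ v → y v i)
        ∎
      where
      open LP-Constraints lp
      open ≈-Reasoning

theorem5 : ∀ {c ℓ₁ ℓ₂} (F : OrderedField c ℓ₁ ℓ₂) →
    let open OrderedField F
        open MHV F in
    ∀ (n k : ℕ) → 2 ≤ℕ k → (I : Instance n k) →
    (∀ (y : Fin n → Fin k → Carrier) → LP-Feasible I y ⇔ CP-Feasible I y)
    × (∀ (y zᶜ : Fin n → Fin k → Carrier) (z : Fin n → Carrier) →
       LP-Constraints I y zᶜ z →
       (∀ (i : Fin k) → ∃[ π ] Sorts π (λ v → y v i))
       × (∀ (π : Fin k → Permutation′ n) →
          (∀ (i : Fin k) → Sorts (π i) (λ v → y v i)) →
          LP-objective I z ≈ CP-objective I π y))
theorem5 F n k 2≤k I =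
    LP⇔CP F I
  , λ y zᶜ z lp →
      feasible-sortable F I 2≤k (to (LP⇔CP F I y) (zᶜ , z , lp))
    , objectives-agree F I lp
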